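{- Let $n\geq 2$ be an integer and let $f:\mathbb{Z}^n\rightarrow \mathbb{Z}^n$ be a map. The following properties are equivalent: (i) $f$ preserves all congruences of the additive group $(\mathbb{Z},+)^n$; (ii) $f$ preserves the congruences of $(\mathbb{Z},+)^n$ associated with the subgroups $\mathbb{Z}_{(k)}$ and $\mathbb{Z}_{(k,l)}$ for all $k,l<n$; (iii) there are $(a_i)_{i<n}\in \mathbb{Z}^n$ and $m\in \mathbb{Z}$ such that $f((x_i)_{i<n})=(a_i)_{i<n}+(m\cdot x_0,\dots,m\cdot x_{n-1})$ for all $(x_0,\dots,x_{n-1})\in \mathbb{Z}^n$.
   Context: Coordinates of elements of $\mathbb{Z}^n$ are indexed by $0,\dots,n-1$. For $k,l<n$, set $\mathbb{Z}_{(k)}:=\{(x_i)_{i<n}\in\mathbb{Z}^n: x_i=0 \text{ for all } i\neq k\}$ and $\mathbb{Z}_{(k,l)}:=\{(x_i)_{i<n}\in\mathbb{Z}^n: x_i=0\text{ for all } i\notin\{k,l\}\text{ and } x_k=-x_l\}$. The congruence associated with a subgroup $H$ of $\mathbb{Z}^n$ is the equivalence relation $x\equiv y$ iff $x-y\in H$; the congruences of the group are exactly these relations. A map $f$ preserves an equivalence relation $\rho$ if $(x,y)\in\rho$ implies $(f(x),f(y))\in\rho$. -}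

module Defs where

open import Algebra.Definitions using (Congruent₂)
open import Data.Fin.Base using (Fin)
open import Data.Integer.Base using (ℤ; 0ℤ; -_) renaming (_+_ to _+ℤ_; _-_ to _-ℤ_; _*_ to _*ℤ_)
open import Data.Nat.Base using (ℕ)
open import Data.Product.Base using (_×_; ∃-syntax)
open import Data.Sum.Base using (_⊎_)
open import Data.Vec.Base using (Vec; lookup; map; zipWith)
open import Level using (0ℓ)
open import Relation.Binary.Core using (Rel; _Preserves_⟶_)
open import Relation.Binary.PropositionalEquality.Core using (_≡_; _≢_)
open import Relation.Binary.Structures using (IsEquivalence)
open import Relation.Nullary.Negation.Core using (¬_)
open import Relation.Unary using (Pred; _∈_)

infixl 6 _+_ _-_
infixr 7 _·_

ℤ^_ : ℕ → Set
ℤ^ n = Vec ℤ n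

_+_ : ∀ {n} → ℤ^ n → ℤ^ n → ℤ^ n
_+_ = zipWith _+ℤ_

_-_ : ∀ {n} → ℤ^ n → ℤ^ n → ℤ^ n
_-_ = zipWith _-ℤ_

_·_ : ∀ {n} → ℤ → ℤ^ n → ℤ^ n
m · x = map (m *ℤ_) x

-- Compatibility with negation follows from +-cong: adding (- x) + (- y) to
-- both sides of x ∼ y gives - y ∼ - x.
record IsCongruence {n : ℕ} (_∼_ : Rel (ℤ^ n) 0ℓ) : Set where
  field
    isEquivalence : IsEquivalence _∼_
    +-cong        : Congruent₂ _∼_ _+_

congruenceOf : ∀ {n} → Pred (ℤ^ n) 0ℓ → Rel (ℤ^ n) 0ℓ
congruenceOf H x y = (x - y) ∈ H

ℤ₍_₎ : ∀ {n} → Fin n → Pred (ℤ^ n) 0ℓ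
ℤ₍ k ₎ x = ∀ i → i ≢ k → lookup x i ≡ 0ℤ

-- The case k = l is included; ℤ₍ k , k ₎ is then the trivial subgroup.
ℤ₍_,_₎ : ∀ {n} → Fin n → Fin n → Pred (ℤ^ n) 0ℓ
ℤ₍ k , l ₎ x =
  (∀ i → ¬ (i ≡ k ⊎ i ≡ l) → lookup x i ≡ 0ℤ) × lookup x k ≡ - lookup x l

PreservesAllCongruences : ∀ {n} → (ℤ^ n → ℤ^ n) → Set₁
PreservesAllCongruences {n} f =
  ∀ (ρ : Rel (ℤ^ n) 0ℓ) → IsCongruence ρ → f Preserves ρ ⟶ ρ

PreservesBasicCongruences : ∀ {n} → (ℤ^ n → ℤ^ n) → Set
PreservesBasicCongruences f =
  (∀ k → f Preserves congruenceOf ℤ₍ k ₎ ⟶ congruenceOf ℤ₍ k ₎) ×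
  (∀ k l → f Preserves congruenceOf ℤ₍ k , l ₎ ⟶ congruenceOf ℤ₍ k , l ₎)

IsTranslatedHomothety : ∀ {n} → (ℤ^ n → ℤ^ n) → Set
IsTranslatedHomothety {n} f =
  ∃[ a ] ∃[ m ] (∀ (x : ℤ^ n) → f x ≡ a + m · x)

{-# OPTIONS --safe #-}
-- The congruences of the ℤ₍ k ₎ force f to act coordinatewise, f(x)ᵢ = gᵢ(xᵢ);
-- those of the ℤ₍ k , l ₎ force the increments gₖ(s + 1) - gₖ(s) and
-- gₗ(t + 1) - gₗ(t) to agree for k ≢ l and all s, t. Since n ≥ 2, all the
-- increments equal one constant m, so that gᵢ(t) = gᵢ(0) + m t.
module Submission where

open import Defs
open import Data.Fin.Base using (Fin; zero; suc)
open import Data.Fin.Properties using (_≟_)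
open import Data.Integer.Base as ℤ using (ℤ; +_; -[1+_]; 0ℤ; 1ℤ) renaming (-_ to -ℤ_)
import Data.Integer.Properties as ℤ
open import Data.Integer.Tactic.RingSolver using (solve-∀)
open import Data.Nat.Base using (ℕ; _≤_; zero; suc; s≤s)
open import Data.Product.Base using (_×_; _,_; proj₁; proj₂)
open import Data.Sum.Base using (_⊎_; inj₁; inj₂)
open import Data.Vec.Base using (Vec; []; _∷_; lookup; map; replicate; _[_]≔_)
open import Data.Vec.Properties
  using (lookup∘update; lookup∘update′; lookup-map; lookup-replicate; lookup-zipWith)
open import Data.Vec.Relation.Binary.Pointwise.Extensional using (ext; Pointwise-≡⇒≡)
open import Function.Base using (_∘_)
open import Function.Bundles using (_⇔_; mk⇔)
open import Level using (0ℓ)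
open import Relation.Binary.Core using (Rel)
open import Relation.Binary.PropositionalEquality
  using (_≡_; _≢_; refl; sym; trans; cong; cong₂; subst; subst₂; module ≡-Reasoning)
open import Relation.Binary.Structures using (IsEquivalence)
open import Relation.Nullary.Decidable.Core using (yes; no)
open import Relation.Nullary.Negation.Core using (¬_)
open import Relation.Unary using (Pred; _∈_)

open ≡-Reasoning

-- Induction on the integers, and comparing vectors one coordinate at a time.

private
  variable
    n : ℕ

ℤ-induction : (P : ℤ → Set) → P 0ℤ →
  (∀ t → P t → P (1ℤ ℤ.+ t)) → (∀ t → P (1ℤ ℤ.+ t) → P t) → ∀ t → P t
ℤ-induction P base up down (+ zero)       = base
ℤ-induction P base up down (+ suc k)      = up (+ k) (ℤ-induction P base up down (+ k))
ℤ-induction P base up down -[1+ zero ]    = down -[1+ 0 ] base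
ℤ-induction P base up down -[1+ suc k ]   =
  down -[1+ suc k ] (ℤ-induction P base up down -[1+ k ])

constantIncrement⇒affine : (g : ℤ → ℤ) (m : ℤ) →
  (∀ t → g (1ℤ ℤ.+ t) ℤ.- g t ≡ m) → ∀ t → g t ≡ g 0ℤ ℤ.+ m ℤ.* t
constantIncrement⇒affine g m increment = ℤ-induction _ base up down
  where
  base : g 0ℤ ≡ g 0ℤ ℤ.+ m ℤ.* 0ℤ
  base = sym (trans (cong (ℤ._+_ (g 0ℤ)) (ℤ.*-zeroʳ m)) (ℤ.+-identityʳ _))

  up : ∀ t → g t ≡ g 0ℤ ℤ.+ m ℤ.* t → g (1ℤ ℤ.+ t) ≡ g 0ℤ ℤ.+ m ℤ.* (1ℤ ℤ.+ t)
  up t eq = begin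
    g (1ℤ ℤ.+ t)                           ≡⟨ split (g (1ℤ ℤ.+ t)) (g t) ⟩
    (g (1ℤ ℤ.+ t) ℤ.- g t) ℤ.+ g t         ≡⟨ cong₂ ℤ._+_ (increment t) eq ⟩
    m ℤ.+ (g 0ℤ ℤ.+ m ℤ.* t)               ≡⟨ regroup m (g 0ℤ) t ⟩
    g 0ℤ ℤ.+ m ℤ.* (1ℤ ℤ.+ t)              ∎
    where
    split : ∀ a b → a ≡ (a ℤ.- b) ℤ.+ b
    split = solve-∀
    regroup : ∀ m a t → m ℤ.+ (a ℤ.+ m ℤ.* t) ≡ a ℤ.+ m ℤ.* (1ℤ ℤ.+ t)
    regroup = solve-∀

  down : ∀ t → g (1ℤ ℤ.+ t) ≡ g 0ℤ ℤ.+ m ℤ.* (1ℤ ℤ.+ t) → g t ≡ g 0ℤ ℤ.+ m ℤ.* t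
  down t eq = begin
    g t                                            ≡⟨ split (g (1ℤ ℤ.+ t)) (g t) ⟩
    g (1ℤ ℤ.+ t) ℤ.- (g (1ℤ ℤ.+ t) ℤ.- g t)        ≡⟨ cong₂ ℤ._-_ eq (increment t) ⟩
    (g 0ℤ ℤ.+ m ℤ.* (1ℤ ℤ.+ t)) ℤ.- m              ≡⟨ regroup m (g 0ℤ) t ⟩
    g 0ℤ ℤ.+ m ℤ.* t                               ∎
    where
    split : ∀ a b → b ≡ a ℤ.- (a ℤ.- b)
    split = solve-∀
    regroup : ∀ m a t → (a ℤ.+ m ℤ.* (1ℤ ℤ.+ t)) ℤ.- m ≡ a ℤ.+ m ℤ.* t
    regroup = solve-∀

lookup-extensional : ∀ {A : Set} {x y : Vec A n} → (∀ i → lookup x i ≡ lookup y i) → x ≡ y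
lookup-extensional eq = Pointwise-≡⇒≡ (ext eq)

-- Turn `x` into `y` entry by entry from the head: where they agree nothing changes, and elsewhere
-- `h` does not see the update. Composing `h` with `b ∷_` keeps the entries already replaced.
unaffectedByDifferences : ∀ {A B : Set} (h : Vec A n → B) (x y : Vec A n) →
  (∀ k → lookup x k ≡ lookup y k ⊎ (∀ z c → h (z [ k ]≔ c) ≡ h z)) → h x ≡ h y
unaffectedByDifferences h []       []       _ = refl
unaffectedByDifferences h (a ∷ x) (b ∷ y) unaffected =
  trans (changeHead (unaffected zero))
        (unaffectedByDifferences (h ∘ (b ∷_)) x y tailUnaffected)
  where
  changeHead : a ≡ b ⊎ (∀ z c → h (z [ zero ]≔ c) ≡ h z) → h (a ∷ x) ≡ h (b ∷ x)
  changeHead (inj₁ refl) = refl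
  changeHead (inj₂ free) = sym (free (a ∷ x) b)

  tailUnaffected : ∀ k →
    lookup x k ≡ lookup y k ⊎ (∀ z c → h (b ∷ (z [ k ]≔ c)) ≡ h (b ∷ z))
  tailUnaffected k with unaffected (suc k)
  ... | inj₁ eq   = inj₁ eq
  ... | inj₂ free = inj₂ (λ z → free (b ∷ z))

-- Identities in the group `ℤ^ n`.

neg : ℤ^ n → ℤ^ n
neg = map -ℤ_

x-x≡0 : (x : ℤ^ n) → x - x ≡ replicate n 0ℤ
x-x≡0 []      = refl
x-x≡0 (a ∷ x) = cong₂ _∷_ (ℤ.+-inverseʳ a) (x-x≡0 x)

neg-[x-y] : (x y : ℤ^ n) → neg (x - y) ≡ y - x
neg-[x-y] []      []      = refl
neg-[x-y] (a ∷ x) (b ∷ y) = cong₂ _∷_ (eq a b) (neg-[x-y] x y)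
  where
  eq : ∀ a b → -ℤ (a ℤ.- b) ≡ b ℤ.- a
  eq = solve-∀

telescope : (x y z : ℤ^ n) → (x - y) + (y - z) ≡ x - z
telescope []      []      []      = refl
telescope (a ∷ x) (b ∷ y) (c ∷ z) = cong₂ _∷_ (eq a b c) (telescope x y z)
  where
  eq : ∀ a b c → (a ℤ.- b) ℤ.+ (b ℤ.- c) ≡ a ℤ.- c
  eq = solve-∀

+-−-interchange : (x y u v : ℤ^ n) → (x - y) + (u - v) ≡ (x + u) - (y + v)
+-−-interchange []      []      []      []      = refl
+-−-interchange (a ∷ x) (b ∷ y) (c ∷ u) (d ∷ v) = cong₂ _∷_ (eq a b c d) (+-−-interchange x y u v)
  where
  eq : ∀ a b c d → (a ℤ.- b) ℤ.+ (c ℤ.- d) ≡ (a ℤ.+ c) ℤ.- (b ℤ.+ d)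
  eq = solve-∀

-- With its companion below, this evaluates both sides of `x ∼ y` after adding `neg x + neg y`.
x+[neg-x+neg-y] : (x y : ℤ^ n) → x + (neg x + neg y) ≡ neg y
x+[neg-x+neg-y] []      []      = refl
x+[neg-x+neg-y] (a ∷ x) (b ∷ y) = cong₂ _∷_ (eq a b) (x+[neg-x+neg-y] x y)
  where
  eq : ∀ a b → a ℤ.+ (-ℤ a ℤ.+ -ℤ b) ≡ -ℤ b
  eq = solve-∀

y+[neg-x+neg-y] : (x y : ℤ^ n) → y + (neg x + neg y) ≡ neg x
y+[neg-x+neg-y] []      []      = refl
y+[neg-x+neg-y] (a ∷ x) (b ∷ y) = cong₂ _∷_ (eq a b) (y+[neg-x+neg-y] x y)
  where
  eq : ∀ a b → b ℤ.+ (-ℤ a ℤ.+ -ℤ b) ≡ -ℤ a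
  eq = solve-∀

·-zeroˡ : (x : ℤ^ n) → 0ℤ · x ≡ replicate n 0ℤ
·-zeroˡ []      = refl
·-zeroˡ (a ∷ x) = cong₂ _∷_ (ℤ.*-zeroˡ a) (·-zeroˡ x)

·-suc : (m : ℤ) (x : ℤ^ n) → x + m · x ≡ (1ℤ ℤ.+ m) · x
·-suc m []      = refl
·-suc m (a ∷ x) = cong₂ _∷_ (eq m a) (·-suc m x)
  where
  eq : ∀ m a → a ℤ.+ m ℤ.* a ≡ (1ℤ ℤ.+ m) ℤ.* a
  eq = solve-∀

neg+·-suc : (m : ℤ) (x : ℤ^ n) → neg x + (1ℤ ℤ.+ m) · x ≡ m · x
neg+·-suc m []      = refl
neg+·-suc m (a ∷ x) = cong₂ _∷_ (eq m a) (neg+·-suc m x)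
  where
  eq : ∀ m a → -ℤ a ℤ.+ (1ℤ ℤ.+ m) ℤ.* a ≡ m ℤ.* a
  eq = solve-∀

-- From (iii) to (i): congruences are compatible with integer multiples.

module _ {ρ : Rel (ℤ^ n) 0ℓ} (isCongruence : IsCongruence ρ) where
  open IsCongruence isCongruence
  private module ρ = IsEquivalence isEquivalence

  neg-cong : ∀ {x y} → ρ x y → ρ (neg x) (neg y)
  neg-cong {x} {y} x∼y =
    ρ.sym (subst₂ ρ (x+[neg-x+neg-y] x y) (y+[neg-x+neg-y] x y) (+-cong x∼y ρ.refl))

  -- Induction on `m`: going up adds the given pair, going down adds its negatives.
  ·-cong : ∀ m {x y} → ρ x y → ρ (m · x) (m · y)
  ·-cong m {x} {y} x∼y = ℤ-induction (λ m → ρ (m · x) (m · y))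
    (ρ.reflexive (trans (·-zeroˡ x) (sym (·-zeroˡ y))))
    (λ m mx∼my → subst₂ ρ (·-suc m x) (·-suc m y) (+-cong x∼y mx∼my))
    (λ m mx∼my → subst₂ ρ (neg+·-suc m x) (neg+·-suc m y) (+-cong (neg-cong x∼y) mx∼my))
    m

translatedHomothety⇒preservesAll : (f : ℤ^ n → ℤ^ n) →
  IsTranslatedHomothety f → PreservesAllCongruences f
translatedHomothety⇒preservesAll f (a , m , f≡) ρ isCongruence {x} {y} x∼y =
  subst₂ ρ (sym (f≡ x)) (sym (f≡ y))
    (+-cong (IsEquivalence.refl isEquivalence) (·-cong isCongruence m x∼y))
  where open IsCongruence isCongruence

-- From (i) to (ii): subgroups yield congruences.

congruenceOf-isCongruence : (H : Pred (ℤ^ n) 0ℓ) →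
  replicate n 0ℤ ∈ H → (∀ {x} → x ∈ H → neg x ∈ H) → (∀ {x y} → x ∈ H → y ∈ H → x + y ∈ H) →
  IsCongruence (congruenceOf H)
congruenceOf-isCongruence H 0∈H neg-closed +-closed = record
  { isEquivalence = record
    { refl  = λ {x} → subst H (sym (x-x≡0 x)) 0∈H
    ; sym   = λ {x y} p → subst H (neg-[x-y] x y) (neg-closed p)
    -- Closure under sums serves twice: differences telescope here, and below they are regrouped by
    -- commutativity.
    ; trans = λ {x y z} p q → subst H (telescope x y z) (+-closed p q)
    }
  ; +-cong = λ {x y u v} p q → subst H (+-−-interchange x y u v) (+-closed p q)
  }

lookup-neg≡0 : ∀ (x : ℤ^ n) i → lookup x i ≡ 0ℤ → lookup (neg x) i ≡ 0ℤ
lookup-neg≡0 x i eq = trans (lookup-map i -ℤ_ x) (cong -ℤ_ eq)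

lookup-+≡0 : ∀ (x y : ℤ^ n) i → lookup x i ≡ 0ℤ → lookup y i ≡ 0ℤ → lookup (x + y) i ≡ 0ℤ
lookup-+≡0 x y i p q = trans (lookup-zipWith ℤ._+_ i x y) (cong₂ ℤ._+_ p q)

ℤ₍k₎-isCongruence : (k : Fin n) → IsCongruence (congruenceOf ℤ₍ k ₎)
ℤ₍k₎-isCongruence k = congruenceOf-isCongruence ℤ₍ k ₎
  (λ i _ → lookup-replicate i 0ℤ)
  (λ {x} p i i≢k → lookup-neg≡0 x i (p i i≢k))
  (λ {x y} p q i i≢k → lookup-+≡0 x y i (p i i≢k) (q i i≢k))

ℤ₍k,l₎-isCongruence : (k l : Fin n) → IsCongruence (congruenceOf (ℤ₍_,_₎ k l))
ℤ₍k,l₎-isCongruence k l = congruenceOf-isCongruence (ℤ₍_,_₎ k l)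
  ((λ i _ → lookup-replicate i 0ℤ) ,
   trans (lookup-replicate k 0ℤ) (cong -ℤ_ (sym (lookup-replicate l 0ℤ))))
  (λ {x} (p , p′) →
    (λ i i∉ → lookup-neg≡0 x i (p i i∉)) ,
    trans (lookup-map k -ℤ_ x) (cong -ℤ_ (trans p′ (sym (lookup-map l -ℤ_ x)))))
  (λ {x y} (p , p′) (q , q′) →
    (λ i i∉ → lookup-+≡0 x y i (p i i∉) (q i i∉)) ,
    (begin
      lookup (x + y) k                        ≡⟨ lookup-zipWith ℤ._+_ k x y ⟩
      lookup x k ℤ.+ lookup y k               ≡⟨ cong₂ ℤ._+_ p′ q′ ⟩
      -ℤ lookup x l ℤ.+ -ℤ lookup y l           ≡⟨ ℤ.neg-distrib-+ (lookup x l) (lookup y l) ⟨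
      -ℤ (lookup x l ℤ.+ lookup y l)           ≡⟨ cong -ℤ_ (lookup-zipWith ℤ._+_ l x y) ⟨
      -ℤ lookup (x + y) l                      ∎))

preservesAll⇒preservesBasic : (f : ℤ^ n → ℤ^ n) →
  PreservesAllCongruences f → PreservesBasicCongruences f
preservesAll⇒preservesBasic f preserves =
  (λ k → preserves _ (ℤ₍k₎-isCongruence k)) ,
  (λ k l → preserves _ (ℤ₍k,l₎-isCongruence k l))

-- From (ii) to (iii): coordinatewise action and equal increments.

lookup-≡⇒-≡0 : ∀ (x y : ℤ^ n) i → lookup x i ≡ lookup y i → lookup (x - y) i ≡ 0ℤ
lookup-≡⇒-≡0 x y i eq = trans (lookup-zipWith ℤ._-_ i x y) (ℤ.i≡j⇒i-j≡0 eq)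

lookup--≡0⇒≡ : ∀ (x y : ℤ^ n) i → lookup (x - y) i ≡ 0ℤ → lookup x i ≡ lookup y i
lookup--≡0⇒≡ x y i eq =
  ℤ.i-j≡0⇒i≡j _ _ (trans (sym (lookup-zipWith ℤ._-_ i x y)) eq)

module _ (f : ℤ^ n → ℤ^ n) where

  -- Evaluating on constant vectors makes the value at `0ℤ` an entry of `f` at the origin, which
  -- becomes the translation vector.
  coordinateMap : Fin n → ℤ → ℤ
  coordinateMap i t = lookup (f (replicate n t)) i

  increment : Fin n → ℤ → ℤ
  increment i t = coordinateMap i (1ℤ ℤ.+ t) ℤ.- coordinateMap i t

module _ (f : ℤ^ n → ℤ^ n) (preserves : PreservesBasicCongruences f) where

  -- An update at `k` stays within a class of `ℤ₍ k ₎`, so the two images can differ only at `k`.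
  update-other : ∀ {k i} → i ≢ k → ∀ z c → lookup (f (z [ k ]≔ c)) i ≡ lookup (f z) i
  update-other {k} {i} i≢k z c = lookup--≡0⇒≡ (f (z [ k ]≔ c)) (f z) i
    (proj₁ preserves k {z [ k ]≔ c} {z}
      (λ j j≢k → lookup-≡⇒-≡0 (z [ k ]≔ c) z j (lookup∘update′ j≢k z c)) i i≢k)

  -- Compare `x` with the constant vector of value `lookup x i`: they agree at `i`, and no other
  -- coordinate influences output `i`.
  coordinatewise : ∀ x i → lookup (f x) i ≡ coordinateMap f i (lookup x i)
  coordinatewise x i =
    unaffectedByDifferences (λ z → lookup (f z) i) x (replicate n (lookup x i)) agree
    where
    agree : ∀ k → lookup x k ≡ lookup (replicate n (lookup x i)) k
                ⊎ (∀ z c → lookup (f (z [ k ]≔ c)) i ≡ lookup (f z) i)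
    agree k with i ≟ k
    ... | yes refl = inj₁ (sym (lookup-replicate k _))
    ... | no i≢k   = inj₂ (update-other i≢k)

  -- Raising coordinate k from s to 1 + s while lowering coordinate l from
  -- 1 + t to t moves the argument within a class of ℤ₍ k , l ₎.
  increment-≡ : ∀ {k l} → k ≢ l → ∀ s t → increment f k s ≡ increment f l t
  increment-≡ {k} {l} k≢l s t = begin
    increment f k s
      ≡⟨ cong₂ ℤ._-_ (value x k xₖ) (value y k yₖ) ⟨
    lookup (f x) k ℤ.- lookup (f y) k
      ≡⟨ lookup-zipWith ℤ._-_ k (f x) (f y) ⟨
    lookup (f x - f y) k
      ≡⟨ proj₂ (proj₂ preserves k l {x} {y} x∼y) ⟩
    -ℤ lookup (f x - f y) l
      ≡⟨ cong -ℤ_ (lookup-zipWith ℤ._-_ l (f x) (f y)) ⟩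
    -ℤ (lookup (f x) l ℤ.- lookup (f y) l)
      ≡⟨ cong -ℤ_ (cong₂ ℤ._-_ (value x l xₗ) (value y l yₗ)) ⟩
    -- Coordinate `l` was lowered from `y` to `x`, so this difference is minus an increment and the
    -- outer sign cancels.
    -ℤ (coordinateMap f l t ℤ.- coordinateMap f l (1ℤ ℤ.+ t))
      ≡⟨ swap (coordinateMap f l t) (coordinateMap f l (1ℤ ℤ.+ t)) ⟩
    increment f l t ∎
    where
    swap : ∀ a b → -ℤ (a ℤ.- b) ≡ b ℤ.- a
    swap = solve-∀

    0s : ℤ^ n
    0s = replicate n 0ℤ

    -- Since `k ≢ l`, the second update leaves the first intact; the common zeros elsewhere make `x`
    -- and `y` agree off `k` and `l`.
    point : ℤ → ℤ → ℤ^ n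
    point a b = (0s [ k ]≔ a) [ l ]≔ b

    pointₖ : ∀ a b → lookup (point a b) k ≡ a
    pointₖ a b = trans (lookup∘update′ k≢l (0s [ k ]≔ a) b) (lookup∘update k 0s a)

    pointₗ : ∀ a b → lookup (point a b) l ≡ b
    pointₗ a b = lookup∘update l (0s [ k ]≔ a) b

    pointᵢ : ∀ a b {i} → ¬ (i ≡ k ⊎ i ≡ l) → lookup (point a b) i ≡ lookup 0s i
    pointᵢ a b i∉ = trans (lookup∘update′ (i∉ ∘ inj₂) (0s [ k ]≔ a) b) (lookup∘update′ (i∉ ∘ inj₁) 0s a)

    x y : ℤ^ n
    x = point (1ℤ ℤ.+ s) t
    y = point s (1ℤ ℤ.+ t)

    xₖ = pointₖ (1ℤ ℤ.+ s) t
    xₗ = pointₗ (1ℤ ℤ.+ s) t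
    yₖ = pointₖ s (1ℤ ℤ.+ t)
    yₗ = pointₗ s (1ℤ ℤ.+ t)

    value : ∀ z i {c} → lookup z i ≡ c → lookup (f z) i ≡ coordinateMap f i c
    value z i eq = trans (coordinatewise z i) (cong (coordinateMap f i) eq)

    opposite : ∀ s t → (1ℤ ℤ.+ s) ℤ.- s ≡ -ℤ (t ℤ.- (1ℤ ℤ.+ t))
    opposite = solve-∀

    x∼y : congruenceOf (ℤ₍_,_₎ k l) x y
    x∼y =
      (λ i i∉ → lookup-≡⇒-≡0 x y i (trans (pointᵢ (1ℤ ℤ.+ s) t i∉) (sym (pointᵢ s (1ℤ ℤ.+ t) i∉)))) ,
      (begin
        lookup (x - y) k                 ≡⟨ lookup-zipWith ℤ._-_ k x y ⟩
        lookup x k ℤ.- lookup y k        ≡⟨ cong₂ ℤ._-_ xₖ yₖ ⟩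
        (1ℤ ℤ.+ s) ℤ.- s                 ≡⟨ opposite s t ⟩
        -ℤ (t ℤ.- (1ℤ ℤ.+ t))             ≡⟨ cong -ℤ_ (cong₂ ℤ._-_ xₗ yₗ) ⟨
        -ℤ (lookup x l ℤ.- lookup y l)    ≡⟨ cong -ℤ_ (lookup-zipWith ℤ._-_ l x y) ⟨
        -ℤ lookup (x - y) l               ∎)

preservesBasic⇒translatedHomothety : 2 ≤ n → (f : ℤ^ n → ℤ^ n) →
  PreservesBasicCongruences f → IsTranslatedHomothety f
preservesBasic⇒translatedHomothety {suc (suc n)} (s≤s (s≤s _)) f preserves =
  a , m , λ x → lookup-extensional (λ i → begin
    lookup (f x) i                                 ≡⟨ coordinatewise f preserves x i ⟩
    coordinateMap f i (lookup x i)                 ≡⟨ constantIncrement⇒affine (coordinateMap f i) m (increment≡m i) (lookup x i) ⟩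
    lookup a i ℤ.+ m ℤ.* lookup x i                ≡⟨ cong (ℤ._+_ (lookup a i)) (lookup-map i (m ℤ.*_) x) ⟨
    lookup a i ℤ.+ lookup (m · x) i                ≡⟨ lookup-zipWith ℤ._+_ i a (m · x) ⟨
    lookup (a + m · x) i                           ∎)
  where
  a : ℤ^ suc (suc n)
  a = f (replicate _ 0ℤ)

  m : ℤ
  m = increment f zero 0ℤ

  increment≡m : ∀ i t → increment f i t ≡ m
  increment≡m (suc i) t = increment-≡ f preserves {suc i} {zero} (λ ()) t 0ℤ
  -- Increments are compared only across distinct coordinates, so coordinate `zero` is compared with
  -- itself by way of coordinate `suc zero`, which exists because `n` is at least 2.
  increment≡m zero    t =
    trans (increment-≡ f preserves {zero} {suc zero} (λ ()) t 0ℤ) (increment≡m (suc zero) 0ℤ)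

theorem8p1 : (n : ℕ) → 2 ≤ n → (f : ℤ^ n → ℤ^ n) →
    (PreservesAllCongruences f ⇔ PreservesBasicCongruences f) ×
    (PreservesBasicCongruences f ⇔ IsTranslatedHomothety f)
theorem8p1 n 2≤n f =
  -- The implications form a cycle, so each converse is a composite of the other two.
  mk⇔ (preservesAll⇒preservesBasic f)
      (translatedHomothety⇒preservesAll f ∘ preservesBasic⇒translatedHomothety 2≤n f) ,
  mk⇔ (preservesBasic⇒translatedHomothety 2≤n f)
      (preservesAll⇒preservesBasic f ∘ translatedHomothety⇒preservesAll f)
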